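{- Let $G=(V,E)$ be a finite graph in which each edge carries one of the four decorations $(+,o),(+,s),(-,o),(-,s)$. Let $H$ be the $2$-cover of $G$ encoded by the signs, and decorate each edge of $H$ with the letter ($o$ or $s$) of the edge of $G$ it lies over. For $B\subseteq E$ let $\overline{B}$ denote the graph $(V,B)$ in which each edge with a $-$ sign has its letter swapped ($o\leftrightarrow s$) while edges with a $+$ sign keep their letter; for $A\subseteq E$ the graph $(V,A)$ keeps the original letters. Then the numbers of balanced factorientations satisfy $$g(H)=\sum_{A\subseteq E}g(A)\,g\big(\overline{E\setminus A}\big).$$
   Context: The $2$-cover encoded by the signs has vertex set $V\times\{0,1\}$; an edge $uv$ with sign $+$ lifts to the edges $(u,0)(v,0),(u,1)(v,1)$, and an edge with sign $-$ lifts to $(u,0)(v,1),(u,1)(v,0)$. Given a graph $F$ whose edges are each labelled $o$ or $s$, a factorientation consists of orienting every $o$-edge and deciding for every $s$-edge whether it is in a subgraph or not. The mixed degree of a vertex $v$ is the number of $o$-edges oriented towards $v$ plus the number of selected $s$-edges incident to $v$. The factorientation is balanced if every vertex $v$ has mixed degree $d_F(v)/2$, where $d_F(v)$ is the degree of $v$ in $F$. $g(F)$ denotes the number of balanced factorientations of $F$ (with its labels); $g(A)$ means $g$ of the labelled graph $(V,A)$. -}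

module Defs where

open import Data.Bool using (if_then_else_)
open import Data.Fin using (Fin; zero; suc)
open import Data.Fin.Properties using (all?; inj⇒≟; *↔×)
open import Data.Fin.Subset using (Subset; inside; outside)
open import Data.List using (List; []; _∷_; length; filter; map; concatMap; cartesianProductWith)
open import Data.List.Relation.Unary.All using (All; []; _∷_)
open import Data.Nat using (ℕ; zero; suc; _+_; _*_; _≟_)
open import Data.Nat.ListAction using (sum)
open import Data.Product using (_×_; _,_)
open import Data.Product.Function.NonDependent.Propositional using (_×-↔_)
open import Data.Vec using ([]; _∷_)
open import Function using (_↔_; Inverse)
open import Function.Construct.Identity using (↔-id)
open import Function.Construct.Composition using (_↔-∘_)
open import Function.Construct.Symmetry using (↔-sym)
open import Function.Properties.Inverse using (↔⇒↣)
open import Relation.Binary.Definitions using (DecidableEquality)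
open import Relation.Binary.PropositionalEquality using (_≡_; subst)
open import Relation.Nullary using (Dec; does)
open import Relation.Nullary.Decidable using (map′)

record FiniteSet : Set₁ where
  field
    Carrier     : Set
    size        : ℕ
    enumeration : Carrier ↔ Fin size

  open Inverse enumeration using (to; from; strictlyInverseʳ)

  infix 4 _≟ᵥ_

  _≟ᵥ_ : DecidableEquality Carrier
  _≟ᵥ_ = inj⇒≟ (↔⇒↣ enumeration)

  ∀? : {P : Carrier → Set} → (∀ v → Dec (P v)) → Dec (∀ v → P v)
  ∀? {P} P? = map′ (λ h v → subst P (strictlyInverseʳ v) (h (to v)))
                   (λ h i → h (from i))
                   (all? (λ i → P? (from i)))

-- The edge {end₁, end₂}. The order of the two ends is a mere bookkeeping
-- device, used to name the two orientations of the edge.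
record Edge (V D : Set) : Set where
  constructor edge
  field
    end₁ end₂  : V
    decoration : D

-- Finite graphs with edges decorated by D. The edges are indexed by their
-- position in the list; parallel edges and loops are allowed.
record Graph (D : Set) : Set₁ where
  constructor graph
  field
    V : FiniteSet
    E : List (Edge (FiniteSet.Carrier V) D)

data Sign : Set where
  ⊕ ⊖ : Sign

data Letter : Set where
  o s : Letter

swap : Letter → Letter
swap o = s
swap s = o

Decoration : Set
Decoration = Sign × Letter

data Choice : Letter → Set where
  toEnd₁ toEnd₂       : Choice o
  selected unselected : Choice s

choices : (l : Letter) → List (Choice l)
choices o = toEnd₁ ∷ toEnd₂ ∷ []
choices s = selected ∷ unselected ∷ []

ChoiceAt : {V : Set} → Edge V Letter → Set
ChoiceAt e = Choice (Edge.decoration e)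

allChoices : {V : Set} (es : List (Edge V Letter)) → List (All ChoiceAt es)
allChoices []       = [] ∷ []
allChoices (e ∷ es) = cartesianProductWith _∷_ (choices (Edge.decoration e)) (allChoices es)

module Degrees (V : FiniteSet) where
  open FiniteSet V renaming (Carrier to Vertex)

  [_is_] : Vertex → Vertex → ℕ
  [ u is v ] = if does (u ≟ᵥ v) then 1 else 0

  -- A loop contributes 2 to the degree of its vertex.
  incidence : {D : Set} → Edge Vertex D → Vertex → ℕ
  incidence (edge u w _) v = [ u is v ] + [ w is v ]

  degree : {D : Set} → List (Edge Vertex D) → Vertex → ℕ
  degree es v = sum (map (λ e → incidence e v) es)

  -- As in the degree, a selected s-loop counts twice; an oriented o-loop
  -- counts once, for its head.
  contribution : (e : Edge Vertex Letter) → ChoiceAt e → Vertex → ℕ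
  contribution (edge u w o)   toEnd₁     v = [ u is v ]
  contribution (edge u w o)   toEnd₂     v = [ w is v ]
  contribution e@(edge _ _ s) selected   v = incidence e v
  contribution (edge _ _ s)   unselected v = 0

  mixedDegree : {es : List (Edge Vertex Letter)} → All ChoiceAt es → Vertex → ℕ
  mixedDegree []                 v = 0
  mixedDegree (_∷_ {x = e} c cs) v = contribution e c v + mixedDegree cs v

module _ (F : Graph Letter) where
  open Graph F
  open FiniteSet V using (∀?)
  open Degrees V

  Factorientation : Set
  Factorientation = All ChoiceAt E

  -- mixed degree = degree / 2, the division being exact: a graph with a vertex
  -- of odd degree has no balanced factorientation.
  Balanced : Factorientation → Set
  Balanced φ = ∀ v → 2 * mixedDegree φ v ≡ degree E v

  balanced? : (φ : Factorientation) → Dec (Balanced φ)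
  balanced? φ = ∀? (λ v → 2 * mixedDegree φ v ≟ degree E v)

  g : ℕ
  g = length (filter balanced? (allChoices E))

_×Fin2 : FiniteSet → FiniteSet
V ×Fin2 = record
  { Carrier     = Carrier × Fin 2
  ; size        = size * 2
  ; enumeration = ↔-sym *↔× ↔-∘ (enumeration ×-↔ ↔-id (Fin 2))
  }
  where open FiniteSet V

lift : {V : Set} → Edge V Decoration → List (Edge (V × Fin 2) Letter)
lift (edge u v (⊕ , l)) = edge (u , zero) (v , zero) l ∷ edge (u , suc zero) (v , suc zero) l ∷ []
lift (edge u v (⊖ , l)) = edge (u , zero) (v , suc zero) l ∷ edge (u , suc zero) (v , zero) l ∷ []

cover : Graph Decoration → Graph Letter
cover (graph V E) = graph (V ×Fin2) (concatMap lift E)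

EdgeSubset : {D : Set} → Graph D → Set
EdgeSubset G = Subset (length (Graph.E G))

subsets : (n : ℕ) → List (Subset n)
subsets zero    = [] ∷ []
subsets (suc n) = cartesianProductWith _∷_ (inside ∷ outside ∷ []) (subsets n)

edgeSubsets : {D : Set} (G : Graph D) → List (EdgeSubset G)
edgeSubsets G = subsets (length (Graph.E G))

restrict : {X : Set} (xs : List X) → Subset (length xs) → List X
restrict []       []            = []
restrict (x ∷ xs) (inside  ∷ A) = x ∷ restrict xs A
restrict (x ∷ xs) (outside ∷ A) = restrict xs A

-- The graph (V, A); all vertices are kept.
spanning : {D : Set} (G : Graph D) → EdgeSubset G → Graph D
spanning (graph V E) A = graph V (restrict E A)

redecorate : {D D′ : Set} → (D → D′) → Graph D → Graph D′
redecorate f (graph V E) = graph V (map (λ (edge u v d) → edge u v (f d)) E)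

letter : Decoration → Letter
letter (_ , l) = l

twistedLetter : Decoration → Letter
twistedLetter (⊕ , l) = l
twistedLetter (⊖ , l) = swap l

original : (G : Graph Decoration) → EdgeSubset G → Graph Letter
original G A = redecorate letter (spanning G A)

overline : (G : Graph Decoration) → EdgeSubset G → Graph Letter
overline G B = redecorate twistedLetter (spanning G B)

{-# OPTIONS --safe #-}
-- Put a variable x_v at every vertex. Reading 2 · (mixed degree) − degree as
-- the exponent of x_v, the number g(F) is the constant coefficient of the
-- product over the edges uw of x_u/x_w + x_w/x_u (letter o) or of
-- x_u x_w + 1/(x_u x_w) (letter s). For the cover, put
-- a_v = x_(v,0) x_(v,1) and b_v = x_(v,0) / x_(v,1): the product of the two
-- factors lying over an edge e is the factor of e in the variables a plus the
-- factor of the twisted e in the variables b. Expanding the product over all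
-- edges of these sums gives the sum over A ⊆ E; the constant coefficients
-- agree because (p, q) ↦ (p + q, p − q) is injective on exponents.
module Submission where

open import Defs
open import Data.Bool using (if_then_else_)
open import Data.Fin using (Fin; zero; suc)
open import Data.Fin.Subset using (Subset; ∁; inside; outside)
open import Data.Integer as ℤ using (ℤ; +_; 0ℤ)
import Data.Integer.Properties as ℤ
import Data.Integer.Tactic.RingSolver as ℤ-Solver
open import Data.List using (List; []; _∷_; _++_; length; filter; map; concatMap)
open import Data.List.Properties using (filter-++; length-++; map-++; map-∘; ++-identityʳ)
open import Data.List.Relation.Unary.All using (All; []; _∷_)
open import Data.Nat using (ℕ; _+_; _*_)
open import Data.Nat.ListAction using (sum)
open import Data.Nat.ListAction.Properties using (sum-++)
open import Data.Nat.Properties using (*-distribˡ-+; *-distribʳ-+; +-identityʳ; +-commutativeSemigroup)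
import Data.Nat.Tactic.RingSolver as ℕ-Solver
open import Data.Product using (_×_; _,_; proj₁)
open import Data.Vec using (_∷_)
open import Function using (_∘_)
open import Function.Construct.Composition using (_⇔-∘_)
open import Function.Bundles using (_⇔_; mk⇔; Equivalence)
open import Relation.Binary.PropositionalEquality using (_≡_; _≢_; refl; sym; trans; cong; cong₂; module ≡-Reasoning)
open import Relation.Nullary using (Dec; yes; no; does)
open import Relation.Nullary.Decidable using (does-⇔; dec-false; _×-dec_)
open import Relation.Unary using (Decidable)

-- Indicators, filtered lists and finite sums.

indicator : {P : Set} → Dec P → ℕ
indicator P? = if does P? then 1 else 0

indicator-⇔ : {P Q : Set} (P? : Dec P) (Q? : Dec Q) → P ⇔ Q → indicator P? ≡ indicator Q?
indicator-⇔ P? Q? P⇔Q = cong (if_then 1 else 0) (does-⇔ P⇔Q P? Q?)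

indicator-× : {P Q : Set} (P? : Dec P) (Q? : Dec Q) →
  indicator (P? ×-dec Q?) ≡ indicator P? * indicator Q?
indicator-× (yes _) (yes _) = refl
indicator-× (yes _) (no _)  = refl
indicator-× (no _)  _       = refl

length-filter-singleton : {X : Set} {P : X → Set} (P? : Decidable P) (x : X) →
  length (filter P? (x ∷ [])) ≡ indicator (P? x)
length-filter-singleton P? x with P? x
... | yes _ = refl
... | no _  = refl

length-filter-map : {X Y : Set} {P : Y → Set} (P? : Decidable P) (f : X → Y) (xs : List X) →
  length (filter P? (map f xs)) ≡ length (filter (P? ∘ f) xs)
length-filter-map P? f []       = refl
length-filter-map P? f (x ∷ xs) with P? (f x)
... | yes _ = cong ℕ.suc (length-filter-map P? f xs)
... | no _  = length-filter-map P? f xs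

length-filter-++ : {X : Set} {P : X → Set} (P? : Decidable P) (xs ys : List X) →
  length (filter P? (xs ++ ys)) ≡ length (filter P? xs) + length (filter P? ys)
length-filter-++ P? xs ys = trans (cong length (filter-++ P? xs ys)) (length-++ (filter P? xs))

-- The shape of the list, trailing `[]` included, is what `cartesianProductWith` computes to on a
-- two-element first list. It thus applies directly to `allChoices`, as `∑-two` does to `subsets`.
length-filter-two : {X Y : Set} {P : Y → Set} (P? : Decidable P) (f₁ f₂ : X → Y) (xs : List X) →
  length (filter P? (map f₁ xs ++ map f₂ xs ++ [])) ≡
  length (filter (P? ∘ f₁) xs) + length (filter (P? ∘ f₂) xs)
length-filter-two P? f₁ f₂ xs
  rewrite ++-identityʳ (map f₂ xs)
        | length-filter-++ P? (map f₁ xs) (map f₂ xs)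
        | length-filter-map P? f₁ xs
        | length-filter-map P? f₂ xs = refl

∑ : {X : Set} → List X → (X → ℕ) → ℕ
∑ xs f = sum (map f xs)

∑-cong : {X : Set} (xs : List X) {f h : X → ℕ} → (∀ x → f x ≡ h x) → ∑ xs f ≡ ∑ xs h
∑-cong []       f≗h = refl
∑-cong (x ∷ xs) f≗h = cong₂ _+_ (f≗h x) (∑-cong xs f≗h)

∑-+ : {X : Set} (xs : List X) (f h : X → ℕ) → ∑ xs (λ x → f x + h x) ≡ ∑ xs f + ∑ xs h
∑-+ []       f h = refl
∑-+ (x ∷ xs) f h = trans (cong (λ k → f x + h x + k) (∑-+ xs f h)) (interchange (f x) (h x) _ _)
  where open import Algebra.Properties.CommutativeSemigroup +-commutativeSemigroup using (interchange)

∑-two : {X Y : Set} (f₁ f₂ : X → Y) (xs : List X) (h : Y → ℕ) →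
  ∑ (map f₁ xs ++ map f₂ xs ++ []) h ≡ ∑ xs (h ∘ f₁) + ∑ xs (h ∘ f₂)
∑-two f₁ f₂ xs h
  rewrite ++-identityʳ (map f₂ xs)
        | map-++ h (map f₁ xs) (map f₂ xs)
        | sum-++ (map h (map f₁ xs)) (map h (map f₂ xs))
        | sym (map-∘ {g = h} {f = f₁} xs)
        | sym (map-∘ {g = h} {f = f₂} xs) = refl

-- Exponents of a single edge factor.

signed : Letter → ℤ → ℤ → ℤ
signed o x y = x ℤ.- y
signed s x y = x ℤ.+ y

-- Each lift of a `⊖` edge has only one end at a given level; `0ℤ` stands for the end at the other
-- level.
signed-0+0 : ∀ l x y → signed l x 0ℤ ℤ.+ signed l 0ℤ y ≡ signed l x y
signed-0+0 o = identity
  where identity : ∀ x y → (x ℤ.- 0ℤ) ℤ.+ (0ℤ ℤ.- y) ≡ x ℤ.- y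
        identity = ℤ-Solver.solve-∀
signed-0+0 s = identity
  where identity : ∀ x y → (x ℤ.+ 0ℤ) ℤ.+ (0ℤ ℤ.+ y) ≡ x ℤ.+ y
        identity = ℤ-Solver.solve-∀

-- Subtracting flips the sign of the second end relative to the first. This is the source of the
-- letter swap in the twisted graph.
signed-0−0 : ∀ l x y → signed l x 0ℤ ℤ.- signed l 0ℤ y ≡ signed (swap l) x y
signed-0−0 o = identity
  where identity : ∀ x y → (x ℤ.- 0ℤ) ℤ.- (0ℤ ℤ.- y) ≡ x ℤ.+ y
        identity = ℤ-Solver.solve-∀
signed-0−0 s = identity
  where identity : ∀ x y → (x ℤ.+ 0ℤ) ℤ.- (0ℤ ℤ.+ y) ≡ x ℤ.- y
        identity = ℤ-Solver.solve-∀

signed-00 : ∀ l → signed l 0ℤ 0ℤ ≡ 0ℤ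
signed-00 o = refl
signed-00 s = refl

-- Balanced factorientations as constant coefficients.

module Coefficients (V : FiniteSet) where
  open FiniteSet V renaming (Carrier to Vertex)
  open Degrees V

  Exponent : Set
  Exponent = Vertex → ℤ

  infixl 6 _⊞_ _⊟_
  _⊞_ _⊟_ : Exponent → Exponent → Exponent
  (p ⊞ q) v = p v ℤ.+ q v
  (p ⊟ q) v = p v ℤ.- q v

  -- The factor of e is x^δ + x^−δ.
  δ : Edge Vertex Letter → Exponent
  δ (edge u w l) v = signed l (+ [ u is v ]) (+ [ w is v ])

  Vanishes : Exponent → Set
  Vanishes p = ∀ v → p v ≡ 0ℤ

  vanishes? : (p : Exponent) → Dec (Vanishes p)
  vanishes? p = ∀? (λ v → p v ℤ.≟ 0ℤ)

  -- The constant coefficient of x^p times the product of the factors of the edges.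
  coefficient : List (Edge Vertex Letter) → Exponent → ℕ
  coefficient []       p = indicator (vanishes? p)
  coefficient (e ∷ es) p = coefficient es (p ⊞ δ e) + coefficient es (p ⊟ δ e)

  -- Here `p` is the exponent accumulated from edges already decided, so that an induction on the
  -- edge list can go through.
  BalancedFrom : Exponent → {es : List (Edge Vertex Letter)} → All ChoiceAt es → Set
  BalancedFrom p {es} φ = ∀ v → p v ℤ.+ + (2 * mixedDegree φ v) ≡ + degree es v

  -- A choice on one edge moves the exponent by `d`, twice its contribution minus the incidence. The
  -- hypothesis is put additively so that no natural subtraction occurs.
  balance-step : ∀ (p d : ℤ) (c i m n : ℕ) → + (2 * c) ≡ d ℤ.+ + i →
    (p ℤ.+ + (2 * (c + m)) ≡ + (i + n)) ⇔ (p ℤ.+ d ℤ.+ + (2 * m) ≡ + n)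
  balance-step p d c i m n 2c≡d+i = mk⇔
    (λ h → ∙-cancelˡ (+ i) _ _ (trans (sym lhs) h))
    (λ h → trans lhs (cong (λ x → + i ℤ.+ x) h))
    where
    open import Algebra.Properties.AbelianGroup ℤ.+-0-abelianGroup using (∙-cancelˡ)
    regroup : ∀ p d i m → p ℤ.+ ((d ℤ.+ i) ℤ.+ m) ≡ i ℤ.+ (p ℤ.+ d ℤ.+ m)
    regroup = ℤ-Solver.solve-∀
    lhs : p ℤ.+ + (2 * (c + m)) ≡ + i ℤ.+ (p ℤ.+ d ℤ.+ + (2 * m))
    lhs = begin
      p ℤ.+ + (2 * (c + m))               ≡⟨ cong (λ x → p ℤ.+ + x) (*-distribˡ-+ 2 c m) ⟩
      p ℤ.+ (+ (2 * c) ℤ.+ + (2 * m))     ≡⟨ cong (λ x → p ℤ.+ (x ℤ.+ + (2 * m))) 2c≡d+i ⟩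
      p ℤ.+ ((d ℤ.+ + i) ℤ.+ + (2 * m))   ≡⟨ regroup p d (+ i) (+ (2 * m)) ⟩
      + i ℤ.+ (p ℤ.+ d ℤ.+ + (2 * m))     ∎
      where open ≡-Reasoning

  balancedFrom-∷ : ∀ (p d : Exponent) e (c : ChoiceAt e) {es} (φ : All ChoiceAt es) →
    (∀ v → + (2 * contribution e c v) ≡ d v ℤ.+ + incidence e v) →
    BalancedFrom p {e ∷ es} (c ∷ φ) ⇔ BalancedFrom (p ⊞ d) φ
  balancedFrom-∷ p d e c {es} φ eq = mk⇔
    (λ b v → Equivalence.to (step v) (b v))
    (λ b v → Equivalence.from (step v) (b v))
    where
    step = λ v → balance-step (p v) (d v) (contribution e c v) (incidence e v)
                   (mixedDegree φ v) (degree es v) (eq v)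

  -- In this and the next three identities the left side is the form to which `+ (2 * c)` computes,
  -- so their instances serve as hypotheses of `balancedFrom-∷` as they stand.
  toEnd₁-δ : ∀ u w → u ℤ.+ (u ℤ.+ 0ℤ) ≡ (u ℤ.- w) ℤ.+ (u ℤ.+ w)
  toEnd₁-δ = ℤ-Solver.solve-∀

  toEnd₂-δ : ∀ u w → w ℤ.+ (w ℤ.+ 0ℤ) ≡ ℤ.- (u ℤ.- w) ℤ.+ (u ℤ.+ w)
  toEnd₂-δ = ℤ-Solver.solve-∀

  selected-δ : ∀ u w → (u ℤ.+ w) ℤ.+ ((u ℤ.+ w) ℤ.+ 0ℤ) ≡ (u ℤ.+ w) ℤ.+ (u ℤ.+ w)
  selected-δ = ℤ-Solver.solve-∀

  unselected-δ : ∀ u w → 0ℤ ≡ ℤ.- (u ℤ.+ w) ℤ.+ (u ℤ.+ w)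
  unselected-δ = ℤ-Solver.solve-∀

  -- `P` is arbitrary because fixing the first choice turns the filter into `P? ∘ (c ∷_)`. The
  -- choices `toEnd₁` and `selected` pick the term with exponent `δ e`, the other two the term with
  -- its negative.
  count≡coefficient : ∀ (es : List (Edge Vertex Letter)) p {P : All ChoiceAt es → Set}
    (P? : Decidable P) → (∀ φ → P φ ⇔ BalancedFrom p φ) →
    length (filter P? (allChoices es)) ≡ coefficient es p
  count≡coefficient [] p P? P⇔ = trans (length-filter-singleton P? [])
    (indicator-⇔ (P? []) (vanishes? p) (mk⇔
      (λ h v → trans (sym (ℤ.+-identityʳ (p v))) (Equivalence.to (P⇔ []) h v))
      (λ h → Equivalence.from (P⇔ []) (λ v → trans (ℤ.+-identityʳ (p v)) (h v)))))
  count≡coefficient (e@(edge u w o) ∷ es) p P? P⇔ =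
    trans (length-filter-two P? (toEnd₁ ∷_) (toEnd₂ ∷_) (allChoices es))
      (cong₂ _+_
        (count≡coefficient es (p ⊞ δ e) (P? ∘ (toEnd₁ ∷_)) λ φ →
          balancedFrom-∷ p (δ e) e toEnd₁ φ (λ v → toEnd₁-δ (+ [ u is v ]) (+ [ w is v ])) ⇔-∘ P⇔ (toEnd₁ ∷ φ))
        (count≡coefficient es (p ⊟ δ e) (P? ∘ (toEnd₂ ∷_)) λ φ →
          -- `p ⊟ δ e` unfolds to `p` plus this negated exponent.
          balancedFrom-∷ p (λ v → ℤ.- δ e v) e toEnd₂ φ (λ v → toEnd₂-δ (+ [ u is v ]) (+ [ w is v ])) ⇔-∘ P⇔ (toEnd₂ ∷ φ)))
  count≡coefficient (e@(edge u w s) ∷ es) p P? P⇔ =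
    trans (length-filter-two P? (selected ∷_) (unselected ∷_) (allChoices es))
      (cong₂ _+_
        (count≡coefficient es (p ⊞ δ e) (P? ∘ (selected ∷_)) λ φ →
          balancedFrom-∷ p (δ e) e selected φ (λ v → selected-δ (+ [ u is v ]) (+ [ w is v ])) ⇔-∘ P⇔ (selected ∷ φ))
        (count≡coefficient es (p ⊟ δ e) (P? ∘ (unselected ∷_)) λ φ →
          balancedFrom-∷ p (λ v → ℤ.- δ e v) e unselected φ (λ v → unselected-δ (+ [ u is v ]) (+ [ w is v ])) ⇔-∘ P⇔ (unselected ∷ φ)))

  g≡coefficient : ∀ es → g (graph V es) ≡ coefficient es (λ _ → 0ℤ)
  g≡coefficient es = count≡coefficient es (λ _ → 0ℤ) (balanced? (graph V es)) λ φ → mk⇔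
    (λ b v → trans (ℤ.+-identityˡ _) (cong +_ (b v)))
    (λ b v → ℤ.+-injective (trans (sym (ℤ.+-identityˡ _)) (b v)))

  is-≢ : ∀ {u v} → u ≢ v → [ u is v ] ≡ 0
  is-≢ {u} {v} u≢v = cong (if_then 1 else 0) (dec-false (u ≟ᵥ v) u≢v)

-- The change of variables on the cover.

module Cover (V : FiniteSet) where
  open FiniteSet V renaming (Carrier to Vertex)
  open Degrees V using ([_is_])
  open Degrees (V ×Fin2) using () renaming ([_is_] to [_is_]ᶜ)
  open Coefficients V
  open Coefficients (V ×Fin2) using ()
    renaming (Exponent to Exponentᶜ; δ to δᶜ; coefficient to coefficientᶜ; vanishes? to vanishesᶜ?;
              _⊞_ to _⊞ᶜ_; _⊟_ to _⊟ᶜ_; is-≢ to is-≢ᶜ)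

  pattern 𝟎 = zero
  pattern 𝟏 = suc zero

  is-sameLevel : ∀ u v i → [ (u , i) is (v , i) ]ᶜ ≡ [ u is v ]
  is-sameLevel u v i = indicator-⇔ (FiniteSet._≟ᵥ_ (V ×Fin2) (u , i) (v , i)) (u ≟ᵥ v)
    (mk⇔ (cong proj₁) (cong (_, i)))

  is-01 : ∀ u v → [ (u , 𝟎) is (v , 𝟏) ]ᶜ ≡ 0
  is-01 u v = is-≢ᶜ λ ()

  is-10 : ∀ u v → [ (u , 𝟏) is (v , 𝟎) ]ᶜ ≡ 0
  is-10 u v = is-≢ᶜ λ ()

  -- The exponent of x_(v,0), x_(v,1) when a^p b^q is rewritten by means of
  -- a_v = x_(v,0) x_(v,1) and b_v = x_(v,0) / x_(v,1).
  record Substituted (r : Exponentᶜ) (p q : Exponent) : Set where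
    constructor _,_
    field
      at0 : ∀ v → r (v , 𝟎) ≡ p v ℤ.+ q v
      at1 : ∀ v → r (v , 𝟏) ≡ p v ℤ.- q v
  open Substituted

  -- The factors of e₁ and e₂ multiply to the sum of the factor of e in the
  -- variables a and the factor of e′ in the variables b.
  record Splits (e₁ e₂ : Edge (Vertex × Fin 2) Letter) (e e′ : Edge Vertex Letter) : Set where
    field
      sum0  : ∀ v → δᶜ e₁ (v , 𝟎) ℤ.+ δᶜ e₂ (v , 𝟎) ≡ δ e v
      sum1  : ∀ v → δᶜ e₁ (v , 𝟏) ℤ.+ δᶜ e₂ (v , 𝟏) ≡ δ e v
      diff0 : ∀ v → δᶜ e₁ (v , 𝟎) ℤ.- δᶜ e₂ (v , 𝟎) ≡ δ e′ v
      diff1 : ∀ v → δᶜ e₁ (v , 𝟏) ℤ.- δᶜ e₂ (v , 𝟏) ≡ ℤ.- δ e′ v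

  module _ {e₁ e₂ e e′} (split : Splits e₁ e₂ e e′) {r p q} (sub : Substituted r p q) where
    open Splits split

    -- The four lemmas treat the four pairs of terms from the two lifts. Equal signs move both
    -- levels alike and so change `p`; opposite signs move the levels in opposite directions and so
    -- change `q`.
    substituted-++ : Substituted (r ⊞ᶜ δᶜ e₁ ⊞ᶜ δᶜ e₂) (p ⊞ δ e) q
    substituted-++ .at0 v = trans (ℤ.+-assoc (r _) _ _)
      (trans (cong₂ ℤ._+_ (sub .at0 v) (sum0 v)) (rearrange (p v) (q v) (δ e v)))
      where rearrange : ∀ p q d → p ℤ.+ q ℤ.+ d ≡ p ℤ.+ d ℤ.+ q
            rearrange = ℤ-Solver.solve-∀
    substituted-++ .at1 v = trans (ℤ.+-assoc (r _) _ _)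
      (trans (cong₂ ℤ._+_ (sub .at1 v) (sum1 v)) (rearrange (p v) (q v) (δ e v)))
      where rearrange : ∀ p q d → p ℤ.- q ℤ.+ d ≡ p ℤ.+ d ℤ.- q
            rearrange = ℤ-Solver.solve-∀

    substituted-−− : Substituted (r ⊟ᶜ δᶜ e₁ ⊟ᶜ δᶜ e₂) (p ⊟ δ e) q
    substituted-−− .at0 v = trans (regroup (r _) _ _)
      (trans (cong₂ ℤ._-_ (sub .at0 v) (sum0 v)) (rearrange (p v) (q v) (δ e v)))
      where regroup : ∀ r x y → r ℤ.- x ℤ.- y ≡ r ℤ.- (x ℤ.+ y)
            regroup = ℤ-Solver.solve-∀
            rearrange : ∀ p q d → p ℤ.+ q ℤ.- d ≡ p ℤ.- d ℤ.+ q
            rearrange = ℤ-Solver.solve-∀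
    substituted-−− .at1 v = trans (regroup (r _) _ _)
      (trans (cong₂ ℤ._-_ (sub .at1 v) (sum1 v)) (rearrange (p v) (q v) (δ e v)))
      where regroup : ∀ r x y → r ℤ.- x ℤ.- y ≡ r ℤ.- (x ℤ.+ y)
            regroup = ℤ-Solver.solve-∀
            rearrange : ∀ p q d → p ℤ.- q ℤ.- d ≡ p ℤ.- d ℤ.- q
            rearrange = ℤ-Solver.solve-∀

    substituted-+− : Substituted (r ⊞ᶜ δᶜ e₁ ⊟ᶜ δᶜ e₂) p (q ⊞ δ e′)
    substituted-+− .at0 v = trans (ℤ.+-assoc (r _) _ _)
      (trans (cong₂ ℤ._+_ (sub .at0 v) (diff0 v)) (ℤ.+-assoc (p v) (q v) (δ e′ v)))
    substituted-+− .at1 v = trans (ℤ.+-assoc (r _) _ _)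
      (trans (cong₂ ℤ._+_ (sub .at1 v) (diff1 v)) (rearrange (p v) (q v) (δ e′ v)))
      where rearrange : ∀ p q d → p ℤ.- q ℤ.+ ℤ.- d ≡ p ℤ.- (q ℤ.+ d)
            rearrange = ℤ-Solver.solve-∀

    substituted-−+ : Substituted (r ⊟ᶜ δᶜ e₁ ⊞ᶜ δᶜ e₂) p (q ⊟ δ e′)
    substituted-−+ .at0 v = trans (regroup (r _) _ _)
      (trans (cong₂ ℤ._-_ (sub .at0 v) (diff0 v)) (ℤ.+-assoc (p v) (q v) (ℤ.- δ e′ v)))
      where regroup : ∀ r x y → r ℤ.- x ℤ.+ y ≡ r ℤ.- (x ℤ.- y)
            regroup = ℤ-Solver.solve-∀
    substituted-−+ .at1 v = trans (regroup (r _) _ _)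
      (trans (cong₂ ℤ._-_ (sub .at1 v) (diff1 v)) (rearrange (p v) (q v) (δ e′ v)))
      where regroup : ∀ r x y → r ℤ.- x ℤ.+ y ≡ r ℤ.- (x ℤ.- y)
            regroup = ℤ-Solver.solve-∀
            rearrange : ∀ p q d → p ℤ.- q ℤ.- ℤ.- d ≡ p ℤ.- (q ℤ.- d)
            rearrange = ℤ-Solver.solve-∀

  δᶜ-at : ∀ {x y z} l {m n} → [ x is z ]ᶜ ≡ m → [ y is z ]ᶜ ≡ n →
    δᶜ (edge x y l) z ≡ signed l (+ m) (+ n)
  δᶜ-at l refl refl = refl

  splits-⊕ : ∀ u w l → Splits (edge (u , 𝟎) (w , 𝟎) l) (edge (u , 𝟏) (w , 𝟏) l) (edge u w l) (edge u w l)
  splits-⊕ u w l = record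
    { sum0  = λ v → trans (cong₂ ℤ._+_ (e₁0 v) (e₂0 v)) (ℤ.+-identityʳ _)
    ; sum1  = λ v → trans (cong₂ ℤ._+_ (e₁1 v) (e₂1 v)) (ℤ.+-identityˡ _)
    ; diff0 = λ v → trans (cong₂ ℤ._-_ (e₁0 v) (e₂0 v)) (ℤ.+-identityʳ _)
    ; diff1 = λ v → trans (cong₂ ℤ._-_ (e₁1 v) (e₂1 v)) (ℤ.+-identityˡ _)
    }
    where
    e₁0 : ∀ v → δᶜ (edge (u , 𝟎) (w , 𝟎) l) (v , 𝟎) ≡ δ (edge u w l) v
    e₁0 v = δᶜ-at l (is-sameLevel u v 𝟎) (is-sameLevel w v 𝟎)
    e₁1 : ∀ v → δᶜ (edge (u , 𝟎) (w , 𝟎) l) (v , 𝟏) ≡ 0ℤ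
    e₁1 v = trans (δᶜ-at l (is-01 u v) (is-01 w v)) (signed-00 l)
    e₂0 : ∀ v → δᶜ (edge (u , 𝟏) (w , 𝟏) l) (v , 𝟎) ≡ 0ℤ
    e₂0 v = trans (δᶜ-at l (is-10 u v) (is-10 w v)) (signed-00 l)
    e₂1 : ∀ v → δᶜ (edge (u , 𝟏) (w , 𝟏) l) (v , 𝟏) ≡ δ (edge u w l) v
    e₂1 v = δᶜ-at l (is-sameLevel u v 𝟏) (is-sameLevel w v 𝟏)

  splits-⊖ : ∀ u w l → Splits (edge (u , 𝟎) (w , 𝟏) l) (edge (u , 𝟏) (w , 𝟎) l) (edge u w l) (edge u w (swap l))
  splits-⊖ u w l = record
    { sum0  = λ v → trans (cong₂ ℤ._+_ (e₁0 v) (e₂0 v)) (signed-0+0 l _ _)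
    -- At level 1 the lifts exchange roles: the sum must be commuted, and in `diff1` the difference
    -- changes sign.
    ; sum1  = λ v → trans (cong₂ ℤ._+_ (e₁1 v) (e₂1 v)) (trans (ℤ.+-comm (signed l 0ℤ _) _) (signed-0+0 l _ _))
    ; diff0 = λ v → trans (cong₂ ℤ._-_ (e₁0 v) (e₂0 v)) (signed-0−0 l _ _)
    ; diff1 = λ v → trans (cong₂ ℤ._-_ (e₁1 v) (e₂1 v))
        (trans (antisymmetric (signed l 0ℤ _) _) (cong ℤ.-_ (signed-0−0 l _ _)))
    }
    where
    antisymmetric : ∀ x y → x ℤ.- y ≡ ℤ.- (y ℤ.- x)
    antisymmetric = ℤ-Solver.solve-∀
    e₁0 : ∀ v → δᶜ (edge (u , 𝟎) (w , 𝟏) l) (v , 𝟎) ≡ signed l (+ [ u is v ]) 0ℤ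
    e₁0 v = δᶜ-at l (is-sameLevel u v 𝟎) (is-10 w v)
    e₁1 : ∀ v → δᶜ (edge (u , 𝟎) (w , 𝟏) l) (v , 𝟏) ≡ signed l 0ℤ (+ [ w is v ])
    e₁1 v = δᶜ-at l (is-01 u v) (is-sameLevel w v 𝟏)
    e₂0 : ∀ v → δᶜ (edge (u , 𝟏) (w , 𝟎) l) (v , 𝟎) ≡ signed l 0ℤ (+ [ w is v ])
    e₂0 v = δᶜ-at l (is-10 u v) (is-sameLevel w v 𝟎)
    e₂1 : ∀ v → δᶜ (edge (u , 𝟏) (w , 𝟎) l) (v , 𝟏) ≡ signed l (+ [ u is v ]) 0ℤ
    e₂1 v = δᶜ-at l (is-sameLevel u v 𝟏) (is-01 w v)

  -- Expansion over edge subsets.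

  originalEdges overlineEdges : (E : List (Edge Vertex Decoration)) → Subset (length E) → List (Edge Vertex Letter)
  originalEdges E A = Graph.E (original (graph V E) A)
  overlineEdges E A = Graph.E (overline (graph V E) A)

  -- The expanded product with the variables a and b treated as independent: `A` records which edges
  -- supply their a-factor. Arbitrary `p` and `q` are kept for the induction.
  convolution : List (Edge Vertex Decoration) → Exponent → Exponent → ℕ
  convolution E p q = ∑ (subsets (length E)) λ A →
    coefficient (originalEdges E A) p * coefficient (overlineEdges E (∁ A)) q

  -- If the first edge lies in `A`, it splits the left coefficient into two terms; otherwise it lies
  -- in `∁ A` and splits the right one. Distributivity then separates the sums.
  convolution-∷ : ∀ u w d E p q → let e = edge u w (letter d); e′ = edge u w (twistedLetter d) in
    convolution (edge u w d ∷ E) p q ≡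
    (convolution E (p ⊞ δ e) q + convolution E (p ⊟ δ e) q) +
    (convolution E p (q ⊞ δ e′) + convolution E p (q ⊟ δ e′))
  convolution-∷ u w d E p q = trans (∑-two (inside ∷_) (outside ∷_) S _) (cong₂ _+_
    (trans (∑-cong S (λ A → *-distribʳ-+ (coefficient (overlineEdges E (∁ A)) q)
      (coefficient (originalEdges E A) (p ⊞ δ e)) (coefficient (originalEdges E A) (p ⊟ δ e)))) (∑-+ S _ _))
    (trans (∑-cong S (λ A → *-distribˡ-+ (coefficient (originalEdges E A) p) _ _)) (∑-+ S _ _)))
    where
    S = subsets (length E)
    e = edge u w (letter d)

  substituted-vanishes : ∀ {r p q} → Substituted r p q →
    indicator (vanishesᶜ? r) ≡ indicator (vanishes? p) * indicator (vanishes? q)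
  substituted-vanishes {r} {p} {q} sub =
    trans (indicator-⇔ (vanishesᶜ? r) (vanishes? p ×-dec vanishes? q) (mk⇔ to from))
          (indicator-× (vanishes? p) (vanishes? q))
    where
    double-injective : ∀ x → x ℤ.+ x ≡ 0ℤ → x ≡ 0ℤ
    -- For nonzero `x` the double computes to a nonzero constructor form, so those cases are absurd.
    double-injective (+ ℕ.zero) _ = refl
    double-sum : ∀ p q → p ℤ.+ p ≡ (p ℤ.+ q) ℤ.+ (p ℤ.- q)
    double-sum = ℤ-Solver.solve-∀
    double-difference : ∀ p q → q ℤ.+ q ≡ (p ℤ.+ q) ℤ.- (p ℤ.- q)
    double-difference = ℤ-Solver.solve-∀
    to : (∀ x → r x ≡ 0ℤ) → Vanishes p × Vanishes q
    to h = (λ v → double-injective (p v) (trans (double-sum (p v) (q v))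
                    (cong₂ ℤ._+_ (p+q≡0 v) (p-q≡0 v))))
         , (λ v → double-injective (q v) (trans (double-difference (p v) (q v))
                    (cong₂ ℤ._-_ (p+q≡0 v) (p-q≡0 v))))
      where
      p+q≡0 : ∀ v → p v ℤ.+ q v ≡ 0ℤ
      p+q≡0 v = trans (sym (sub .at0 v)) (h (v , 𝟎))
      p-q≡0 : ∀ v → p v ℤ.- q v ≡ 0ℤ
      p-q≡0 v = trans (sym (sub .at1 v)) (h (v , 𝟏))
    from : Vanishes p × Vanishes q → ∀ x → r x ≡ 0ℤ
    from (p≡0 , q≡0) (v , 𝟎) = trans (sub .at0 v) (cong₂ ℤ._+_ (p≡0 v) (q≡0 v))
    from (p≡0 , q≡0) (v , 𝟏) = trans (sub .at1 v) (cong₂ ℤ._-_ (p≡0 v) (q≡0 v))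

  coefficient-cover : ∀ E {r p q} → Substituted r p q →
    coefficientᶜ (concatMap lift E) r ≡ convolution E p q

  -- The induction step common to both signs: the sign enters only through the splitting.
  coefficient-cover-∷ : ∀ u w d E {e₁ e₂ r p q} →
    Splits e₁ e₂ (edge u w (letter d)) (edge u w (twistedLetter d)) → Substituted r p q →
    coefficientᶜ (e₁ ∷ e₂ ∷ concatMap lift E) r ≡ convolution (edge u w d ∷ E) p q

  coefficient-cover [] sub = trans (substituted-vanishes sub) (sym (+-identityʳ _))
  coefficient-cover (edge u w (⊕ , l) ∷ E) = coefficient-cover-∷ u w (⊕ , l) E (splits-⊕ u w l)
  coefficient-cover (edge u w (⊖ , l) ∷ E) = coefficient-cover-∷ u w (⊖ , l) E (splits-⊖ u w l)

  coefficient-cover-∷ u w d E {p = p} {q} split sub = trans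
    (cong₂ _+_
      (cong₂ _+_ (coefficient-cover E (substituted-++ split sub)) (coefficient-cover E (substituted-+− split sub)))
      (cong₂ _+_ (coefficient-cover E (substituted-−+ split sub)) (coefficient-cover E (substituted-−− split sub))))
    -- The cover yields the sign pairs in the order ++, +-, -+, --; the convolution groups ++ with
    -- -- and +- with -+.
    (trans (rearrange (convolution E _ q) _ _ _) (sym (convolution-∷ u w d E p q)))
    where
    rearrange : ∀ k l m n → (k + l) + (m + n) ≡ (k + n) + (l + m)
    rearrange = ℕ-Solver.solve-∀

theorem1p9 : (G : Graph Decoration) →
    g (cover G) ≡ sum (map (λ A → g (original G A) * g (overline G (∁ A))) (edgeSubsets G))
theorem1p9 G@(graph V E) = begin
  g (cover G)
    ≡⟨ Coefficients.g≡coefficient (V ×Fin2) (concatMap lift E) ⟩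
  Coefficients.coefficient (V ×Fin2) (concatMap lift E) (λ _ → 0ℤ)
    -- All exponents start at zero, and `0ℤ` plus or minus `0ℤ` computes to `0ℤ`.
    ≡⟨ coefficient-cover E ((λ _ → refl) , (λ _ → refl)) ⟩
  convolution E (λ _ → 0ℤ) (λ _ → 0ℤ)
    ≡⟨ ∑-cong (edgeSubsets G) (λ A → cong₂ _*_ (g≡coefficient (originalEdges E A)) (g≡coefficient (overlineEdges E (∁ A)))) ⟨
  sum (map (λ A → g (original G A) * g (overline G (∁ A))) (edgeSubsets G))
    ∎
  where
  open Cover V
  open Coefficients V using (g≡coefficient)
  open ≡-Reasoning
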